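{- Let $T$ be a tree on the vertex set $\{1,\dots,n\}$ with root $r$, let $k\geqslant 3$, let $\Gamma_k$ be a set of $k$ colors, and let $F_1,\dots,F_n$ be fixed strategies on $T$ with color set $\Gamma_k$. Then for every color $c\in \Gamma_k$ which is not dominant for $F_r$, there is a demonic coloring $f$ of $T$ (with respect to $F_1,\dots,F_n$) such that $f(r)=c$. In consequence, every tree $T$ with at least two vertices satisfies $\mu (T)=2$.
   Context: Let $G$ be a finite simple graph on the vertex set $\{1,\dots,n\}$ and let $\Gamma$ be a finite set of colors. A strategy for vertex $i$ is a function $F_i:\Gamma^n\to\Gamma$ whose value $F_i(x_1,\dots,x_n)$ depends only on those coordinates $x_j$ for which $j$ is adjacent to $i$ in $G$. A demonic coloring with respect to strategies $F_1,\dots,F_n$ is an element $(x_1,\dots,x_n)\in\Gamma^n$ (viewed as a coloring $f$ with $f(i)=x_i$) such that $F_i(x_1,\dots,x_n)\neq x_i$ for all $i$. The hat chromatic number $\mu(G)$ is the largest integer $k=|\Gamma|$ for which there exist strategies $F_1,\dots,F_n$ on $G$ admitting no demonic coloring. A cube is a nonempty set of the form $C=C_1\times\dots\times C_n$ with $C_i\subseteq\Gamma_k$; the set $C_i$ is its $i$-th component. For a tree $T$ with root $r$ and a strategy $F_r$ for $r$, a color $d\in\Gamma_k$ is dominant for $F_r$ if $F_r^{ -1}(d)\subseteq\Gamma_k^n$ contains a cube each of whose components has size at least $k-1$. -}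

module Defs where

open import Data.Fin.Base using (Fin)
open import Data.Fin.Subset using (Subset; ∣_∣) renaming (_∈_ to _∈ₛ_)
open import Data.List.Base using (List; []; _∷_; _++_; length)
open import Data.List.Relation.Unary.Linked using (Linked)
open import Data.List.Relation.Unary.Unique.Propositional using (Unique)
open import Data.Nat.Base using (ℕ; _≤_; _∸_)
open import Data.Product.Base using (∃; _×_)
open import Level using (0ℓ)
open import Relation.Binary.Construct.Closure.ReflexiveTransitive using (Star)
open import Relation.Binary.Core using (Rel)
open import Relation.Binary.Definitions using (Symmetric; Irreflexive; Decidable)
open import Relation.Binary.PropositionalEquality.Core using (_≡_; _≢_)
open import Relation.Nullary.Negation.Core using (¬_)

record Graph (n : ℕ) : Set₁ where
  field
    Adj    : Rel (Fin n) 0ℓ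
    sym    : Symmetric Adj
    irrefl : Irreflexive _≡_ Adj
    adj?   : Decidable Adj

open Graph public using (Adj)

Connected : {n : ℕ} → Graph n → Set
Connected G = ∀ i j → Star (Adj G) i j

-- The cycle v — v₁ — … — vₘ — v through m + 1 ≥ 3 distinct vertices,
-- where vs = v₁ , … , vₘ.
record IsCycle {n : ℕ} (G : Graph n) (v : Fin n) (vs : List (Fin n)) : Set where
  field
    long     : 2 ≤ length vs
    distinct : Unique (v ∷ vs)
    closed   : Linked (Adj G) (v ∷ vs ++ v ∷ [])

Acyclic : {n : ℕ} → Graph n → Set
Acyclic G = ∀ v vs → ¬ IsCycle G v vs

-- The graph with no vertices also qualifies; a root or a lower bound on the
-- number of vertices excludes it.
record IsTree {n : ℕ} (G : Graph n) : Set where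
  field
    connected : Connected G
    acyclic   : Acyclic G

Coloring : ℕ → ℕ → Set
Coloring n k = Fin n → Fin k

-- Adjacency is irreflexive, so the guess at i cannot use the color of i.
-- The field `local` also makes the guess respect pointwise equality of colorings.
record Strategy {n : ℕ} (G : Graph n) (k : ℕ) (i : Fin n) : Set where
  field
    guess : Coloring n k → Fin k
    local : ∀ x y → (∀ j → Adj G i j → x j ≡ y j) → guess x ≡ guess y

open Strategy public using (guess)

Strategies : {n : ℕ} → Graph n → ℕ → Set
Strategies {n} G k = (i : Fin n) → Strategy G k i

Demonic : {n : ℕ} {G : Graph n} {k : ℕ} → Strategies G k → Coloring n k → Set
Demonic F x = ∀ i → guess (F i) x ≢ x i

Winnable : {n : ℕ} → Graph n → ℕ → Set
Winnable G k = ∃ λ (F : Strategies G k) → ¬ ∃ (Demonic F)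

-- `IsHatChromaticNumber G m` says μ(G) = m.
record IsHatChromaticNumber {n : ℕ} (G : Graph n) (m : ℕ) : Set where
  field
    winnable : Winnable G m
    largest  : ∀ k → Winnable G k → k ≤ m

_∈∏_ : {n k : ℕ} → Coloring n k → (Fin n → Subset k) → Set
x ∈∏ C = ∀ i → x i ∈ₛ C i

record Cube (n k : ℕ) : Set where
  field
    component : Fin n → Subset k
    nonempty  : ∃ (_∈∏ component)

open Cube public using (component)

Dominant : {n : ℕ} {G : Graph n} {k : ℕ} {r : Fin n} → Strategy G k r → Fin k → Set
Dominant {n} {k = k} F d =
  ∃ λ (C : Cube n k) → (∀ i → k ∸ 1 ≤ ∣ component C i ∣)
                     × (∀ x → x ∈∏ component C → guess F x ≡ d)

{-# OPTIONS --safe #-}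

-- Grow the tree from the root, so that each new vertex u has exactly one neighbor
-- s among the vertices already present (a second one would close a cycle). Peel
-- the vertices off in the reverse order. When u is peeled off, fix a color a for
-- s: at most one color d of u is "exceptional", i.e. such that u guesses d
-- whenever s has color a and each neighbor peeled off before u avoids its own
-- exceptional color. Indeed, for k ≥ 3 each neighbor can avoid two given colors at
-- once, so one and the same guess of u would equal any two exceptional colors.
-- Finally, if a color c of the root is not dominant, then the root guesses wrongly
-- for some non-exceptional colors of the other vertices, and putting the vertices
-- back one by one extends this to a demonic coloring. At most one color of the
-- root fails to be of this kind, so three colors always lose; two colors win
-- already on one edge.

module Submission where

open import Defs
open import Data.Empty using (⊥)
open import Data.Fin.Base using (Fin; zero; suc; punchIn; punchOut; opposite; finToFun; funToFin; fromℕ<)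
open import Data.Fin.Properties using (_≟_; any?; all?; punchInᵢ≢i; punchIn-injective; punchIn-punchOut; finToFun-funToFin)
open import Data.Fin.Subset using (∁; ⁅_⁆; ∣_∣) renaming (_∈_ to _∈ₛ_)
open import Data.Fin.Subset.Properties using (x∈⁅x⁆; x∈∁p⇒x∉p; x∉p⇒x∈∁p; x≢y⇒x∉⁅y⁆; ∣∁p∣≡n∸∣p∣; ∣⁅x⁆∣≡1)
open import Data.List.Base using (List; []; _∷_; [_]; _++_; length; allFin)
open import Data.List.Membership.DecPropositional using (_∈?_)
open import Data.List.Membership.Propositional using (_∈_; _∉_)
open import Data.List.Membership.Propositional.Properties using (∈-++⁺ˡ; ∈-++⁺ʳ; ∈-allFin)
open import Data.List.Properties using (++-assoc)
open import Data.List.Relation.Binary.Subset.Propositional using (_⊆_)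
open import Data.List.Relation.Unary.All as All using (All; []; _∷_)
open import Data.List.Relation.Unary.All.Properties as All using ()
open import Data.List.Relation.Unary.Any using (here; there)
open import Data.List.Relation.Unary.Linked using (Linked; [-]; _∷_)
open import Data.List.Relation.Unary.Unique.Propositional using (Unique; []; _∷_)
open import Data.List.Relation.Unary.Unique.Propositional.Properties using (++⁺)
open import Data.Nat.Base using (ℕ; _≤_; _∸_; z≤n; s≤s)
open import Data.Nat.Properties using (≤-reflexive; ≮⇒≥)
open import Data.Product.Base using (∃; _×_; _,_; proj₁; proj₂)
open import Data.Vec.Functional using (updateAt)
open import Data.Vec.Functional.Properties using (updateAt-updates; updateAt-minimal)
open import Function.Base using (_∘_; const)
open import Relation.Binary.Construct.Closure.ReflexiveTransitive using (Star; ε; _◅_)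
open import Relation.Binary.Definitions using (_Respects_)
open import Relation.Binary.PropositionalEquality using (_≡_; _≢_; _≗_; refl; sym; trans; cong; subst; ≢-sym; module ≡-Reasoning)
open import Relation.Nullary using (¬_; Dec; yes; no; contradiction)
open import Relation.Nullary.Decidable using (map′; ¬?; _×-dec_; _→-dec_; decidable-stable)
open import Relation.Unary using (Pred; Decidable)
open import Level using (0ℓ)

-- Growing a tree from its root

-- The head of the list is the newest vertex and `s` its parent, so recursion on the derivation
-- peels off leaves.
data Grown {n : ℕ} (G : Graph n) (r : Fin n) : List (Fin n) → Set where
  root : Grown G r [ r ]
  grow : ∀ {S u s} → Grown G r S → u ∉ S → s ∈ S → Adj G u s →
         (∀ {t} → t ∈ S → Adj G u t → t ≡ s) → Grown G r (u ∷ S)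

root∈ : ∀ {n} {G : Graph n} {r S} → Grown G r S → r ∈ S
root∈ root                 = here refl
root∈ (grow grown _ _ _ _) = there (root∈ grown)

record SimplePath {n : ℕ} (G : Graph n) (S : List (Fin n)) (s t : Fin n) : Set where
  field
    vertices : List (Fin n)
    within   : All (_∈ S) vertices
    distinct : Unique vertices
    source∈  : s ∈ vertices
    target∈  : t ∈ vertices
    -- That the path starts at s, ends at t and follows edges is stated through
    -- its prolongations, the form in which paths are joined and cycles closed.
    linked   : ∀ {u ys} → Adj G u s → Linked (Adj G) (t ∷ ys) →
               Linked (Adj G) (u ∷ vertices ++ ys)

∉⇒All≢ : ∀ {n} {S : List (Fin n)} {u vs} → u ∉ S → All (_∈ S) vs → All (u ≢_) vs
∉⇒All≢ u∉S = All.map λ w∈S u≡w → u∉S (subst (_∈ _) (sym u≡w) w∈S)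

-- A path ending at the newest vertex is one ending at its parent, prolonged by an edge; `within`
-- keeps it simple, as the older part misses that vertex.
simplePath : ∀ {n} {G : Graph n} {r S} → Grown G r S →
             ∀ {s t} → s ∈ S → t ∈ S → SimplePath G S s t
simplePath {r = r} root (here refl) (here refl) = record
  { vertices = [ r ]
  ; within   = here refl ∷ []
  ; distinct = [] ∷ []
  ; source∈  = here refl
  ; target∈  = here refl
  ; linked   = _∷_
  }
simplePath (grow {u = v} _ _ _ _ _) (here refl) (here refl) = record
  { vertices = [ v ]
  ; within   = here refl ∷ []
  ; distinct = [] ∷ []
  ; source∈  = here refl
  ; target∈  = here refl
  ; linked   = _∷_
  }
simplePath (grow {u = v} grown v∉S p∈S v~p _) (here refl) (there t∈S) = record
  { vertices = v ∷ vertices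
  ; within   = here refl ∷ All.map there within
  ; distinct = ∉⇒All≢ v∉S within ∷ distinct
  ; source∈  = here refl
  ; target∈  = there target∈
  ; linked   = λ u~v tail → u~v ∷ linked v~p tail
  }
  where open SimplePath (simplePath grown p∈S t∈S)
simplePath {G = G} (grow {u = v} grown v∉S p∈S v~p _) (there s∈S) (here refl) = record
  { vertices = vertices ++ [ v ]
  ; within   = All.++⁺ (All.map there within) (here refl ∷ [])
  ; distinct = ++⁺ distinct ([] ∷ []) λ { (w∈vs , here refl) → v∉S (All.lookup within w∈vs) }
  ; source∈  = ∈-++⁺ˡ source∈
  ; target∈  = ∈-++⁺ʳ vertices (here refl)
  ; linked   = λ {u} {ys} u~s tail →
      subst (Linked (Adj G) ∘ (u ∷_)) (sym (++-assoc vertices [ v ] ys))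
            (linked u~s (Graph.sym G v~p ∷ tail))
  }
  where open SimplePath (simplePath grown s∈S p∈S)
simplePath (grow grown _ _ _ _) (there s∈S) (there t∈S) = record
  { vertices = vertices
  ; within   = All.map there within
  ; distinct = distinct
  ; source∈  = source∈
  ; target∈  = target∈
  ; linked   = linked
  }
  where open SimplePath (simplePath grown s∈S t∈S)

two-members : ∀ {A : Set} {s t : A} {xs} → s ≢ t → s ∈ xs → t ∈ xs → 2 ≤ length xs
two-members {xs = _ ∷ []}    s≢t (here refl) (here refl) = contradiction refl s≢t
two-members {xs = _ ∷ _ ∷ _} _   _           _           = s≤s (s≤s z≤n)

-- The path from `s` to `t` misses `u`; were `t` different from `s`, joining its two ends to `u`
-- would close a cycle.
unique-neighbor : ∀ {n} {G : Graph n} {r S u s t} → Acyclic G → Grown G r S → u ∉ S →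
                  s ∈ S → Adj G u s → t ∈ S → Adj G u t → t ≡ s
unique-neighbor {G = G} {u = u} {s} {t} acyclic grown u∉S s∈S u~s t∈S u~t =
  decidable-stable (t ≟ s) λ t≢s → acyclic u vertices record
    { long     = two-members (≢-sym t≢s) source∈ target∈
    ; distinct = ∉⇒All≢ u∉S within ∷ distinct
    ; closed   = linked u~s (Graph.sym G u~t ∷ [-])
    }
  where open SimplePath (simplePath grown s∈S t∈S)

module _ {n : ℕ} {G : Graph n} (acyclic : Acyclic G) {r : Fin n} where

  grow-along : ∀ {S s v} → Grown G r S → s ∈ S → Star (Adj G) s v →
               ∃ λ S′ → Grown G r S′ × S ⊆ S′ × v ∈ S′
  grow-along grown s∈S ε = _ , grown , (λ w∈S → w∈S) , s∈S
  grow-along {S} grown s∈S (_◅_ {j = u} s~u path) with _∈?_ _≟_ u S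
  ... | yes u∈S = grow-along grown u∈S path
  ... | no  u∉S =
    let S′ , grown′ , S⊆S′ , v∈S′ = grow-along
          (grow grown u∉S s∈S u~s (unique-neighbor acyclic grown u∉S s∈S u~s)) (here refl) path
    in  S′ , grown′ , S⊆S′ ∘ there , v∈S′
    where u~s = Graph.sym G s~u

  grow-over : Connected G → (vs : List (Fin n)) → ∃ λ S → Grown G r S × vs ⊆ S
  grow-over connected []       = _ , root , λ ()
  grow-over connected (v ∷ vs) =
    let S  , grown  , vs⊆S        = grow-over connected vs
        S′ , grown′ , S⊆S′ , v∈S′ = grow-along grown (root∈ grown) (connected r v)
    in  S′ , grown′ , λ { (here refl) → v∈S′ ; (there w∈vs) → S⊆S′ (vs⊆S w∈vs) }

tree-grown : ∀ {n} {T : Graph n} → IsTree T → ∀ r → ∃ λ S → Grown T r S × (∀ v → v ∈ S)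
tree-grown {n} isTree r =
  let S , grown , all⊆S = grow-over acyclic connected (allFin n)
  in  S , grown , λ v → all⊆S (∈-allFin v)
  where open IsTree isTree

-- Choosing colors

-- `finToFun` reaches each coloring only up to pointwise equality, hence the demand that `P` respect
-- it.
∃-coloring? : ∀ {n k} {P : Pred (Coloring n k) 0ℓ} → P Respects _≗_ → Decidable P → Dec (∃ P)
∃-coloring? resp P? = map′
  (λ (i , p) → finToFun i , p)
  (λ (f , p) → funToFin f , resp (sym ∘ finToFun-funToFin f) p)
  (any? (P? ∘ finToFun))

avoid-two : ∀ {k} → 3 ≤ k → (d d′ : Fin k) → ∃ λ e → e ≢ d × e ≢ d′
avoid-two (s≤s (s≤s (s≤s _))) d d′ with d ≟ d′
... | yes refl = punchIn d zero , punchInᵢ≢i d zero , punchInᵢ≢i d zero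
-- `punchIn d` lists the colors other than `d`; `q` is the place of `d′` there, and at least one
-- further place remains.
... | no  d≢d′ = punchIn d (punchIn q zero) , punchInᵢ≢i d _ , λ e≡d′ →
  punchInᵢ≢i q zero (punchIn-injective d _ _ (trans e≡d′ (sym (punchIn-punchOut d≢d′))))
  where q = punchOut d≢d′

all-but-one : ∀ {k} {P : Pred (Fin k) 0ℓ} → Fin k → Decidable P →
              (∀ {b b′} → ¬ P b → ¬ P b′ → b ≡ b′) → ∃ λ d → ∀ b → b ≢ d → P b
all-but-one d₀ P? unique with any? (¬? ∘ P?)
... | yes (d , ¬Pd) = d  , λ b b≢d → decidable-stable (P? b) λ ¬Pb → b≢d (unique ¬Pb ¬Pd)
-- Without an exception, `d₀` is a mere default.
... | no  ∄¬P       = d₀ , λ b _   → decidable-stable (P? b) λ ¬Pb → ∄¬P (b , ¬Pb)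

-- Exceptional colors

module _ {n k : ℕ} {G : Graph n} {v : Fin n} (F : Strategy G k v) where

  guess-cong : ∀ {x y} → x ≗ y → guess F x ≡ guess F y
  guess-cong x≗y = Strategy.local F _ _ λ j _ → x≗y j

  Misguesses : Fin k → Pred (Coloring n k) 0ℓ → Set
  Misguesses b Q = ∃ λ g → Q g × guess F g ≢ b

  misguesses? : ∀ b {Q} → Q Respects _≗_ → Decidable Q → Dec (Misguesses b Q)
  misguesses? b resp Q? = ∃-coloring?
    (λ x≗y (q , g≢b) → resp x≗y q , g≢b ∘ trans (guess-cong x≗y))
    (λ g → Q? g ×-dec ¬? (guess F g ≟ b))

  ¬misguesses⇒≡ : ∀ {b Q g} → ¬ Misguesses b Q → Q g → guess F g ≡ b
  ¬misguesses⇒≡ {b} ¬mis q = decidable-stable (guess F _ ≟ b) λ g≢b → ¬mis (_ , q , g≢b)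

  -- Where `b` fails, the guess is constantly `b` on `Q b`. If two colors fail, a coloring common to
  -- both constraints makes them equal.
  misguesses-all-but-one :
    Fin k → (Q : Fin k → Pred (Coloring n k) 0ℓ) →
    (∀ b → Q b Respects _≗_) → (∀ b → Decidable (Q b)) →
    (∀ b b′ → ∃ λ g → Q b g × Q b′ g) →
    ∃ λ d → ∀ b → b ≢ d → Misguesses b (Q b)
  misguesses-all-but-one d₀ Q resp Q? meet = all-but-one d₀
    (λ b → misguesses? b (resp b) (Q? b))
    λ {b} {b′} ¬mis ¬mis′ → let g , q , q′ = meet b b′ in
      trans (sym (¬misguesses⇒≡ ¬mis q)) (¬misguesses⇒≡ ¬mis′ q′)

-- D w a is the color that w has to avoid when its parent has color a.
Exceptions : ℕ → ℕ → Set
Exceptions n k = Fin n → Fin k → Fin k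

-- The color `b` is that of the vertex whose guess is studied, acting as the parent of every `w`.
Avoids : ∀ {n k} → Exceptions n k → Fin k → Pred (Coloring n k) 0ℓ
Avoids D b g = ∀ w → g w ≢ D w b

-- The parent `s` is not peeled off yet: its color is prescribed, and it is exempt from its own
-- entry in `D`.
AvoidsBut : ∀ {n k} → Exceptions n k → Fin n → Fin k → Fin k → Pred (Coloring n k) 0ℓ
AvoidsBut D s a b g = g s ≡ a × (∀ w → w ≢ s → g w ≢ D w b)

module _ {n k : ℕ} (3≤k : 3 ≤ k) {G : Graph n} {v : Fin n} (F : Strategy G k v) (D : Exceptions n k) where

  avoids-meet : ∀ b b′ → ∃ λ g → Avoids D b g × Avoids D b′ g
  avoids-meet b b′ = proj₁ ∘ avoiding , proj₁ ∘ proj₂ ∘ avoiding , proj₂ ∘ proj₂ ∘ avoiding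
    where avoiding = λ w → avoid-two 3≤k (D w b) (D w b′)

  avoids-respects : ∀ b → Avoids D b Respects _≗_
  avoids-respects b x≗y q w = q w ∘ trans (x≗y w)

  avoids? : ∀ b → Decidable (Avoids D b)
  avoids? b g = all? λ w → ¬? (g w ≟ D w b)

  avoids-misguesses? : ∀ b → Dec (Misguesses F b (Avoids D b))
  avoids-misguesses? b = misguesses? F b (avoids-respects b) (avoids? b)

  avoids-misguesses : Fin k → ∃ λ d → ∀ b → b ≢ d → Misguesses F b (Avoids D b)
  avoids-misguesses d₀ = misguesses-all-but-one F d₀ (Avoids D)
    avoids-respects avoids? avoids-meet

  avoidsBut-misguesses : ∀ s a → ∃ λ d → ∀ b → b ≢ d → Misguesses F b (AvoidsBut D s a b)
  avoidsBut-misguesses s a = misguesses-all-but-one F a (AvoidsBut D s a)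
    (λ b x≗y (gs≡a , q) → trans (sym (x≗y s)) gs≡a , λ w w≢s → q w w≢s ∘ trans (x≗y w))
    (λ b g → (g s ≟ a) ×-dec all? λ w → ¬? (w ≟ s) →-dec ¬? (g w ≟ D w b))
    -- Recoloring `s` to `a` keeps both constraints, as `s` is exempt from avoiding.
    λ b b′ → let g , q , q′ = avoids-meet b b′ in
      updateAt g s (const a) , recolored g q , recolored g q′
    where
    recolored : ∀ {b} g → Avoids D b g → AvoidsBut D s a b (updateAt g s (const a))
    recolored g q = updateAt-updates s g ,
      λ w w≢s → q w ∘ trans (sym (updateAt-minimal w s g w≢s))

-- Putting the vertices back

module _ {n k : ℕ} (3≤k : 3 ≤ k) {T : Graph n} (F : Strategies T k) where

  -- `S` holds the vertices put back so far. Outside `S`, `g` is a tentative coloring private to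
  -- `v`; those of different vertices need not agree.
  Foolable : List (Fin n) → Exceptions n k → Coloring n k → Fin n → Set
  Foolable S D f v = ∃ λ g →
    (∀ w → w ∈ S → Adj T v w → g w ≡ f w) ×
    (∀ w → w ∉ S → g w ≢ D w (f v)) ×
    guess (F v) g ≢ f v

  Extendable : List (Fin n) → Exceptions n k → Coloring n k → Set
  Extendable S D f = ∀ v → v ∈ S → Foolable S D f v

  extendable⇒demonic : ∀ {S D f} → (∀ v → v ∈ S) → Extendable S D f → Demonic F f
  extendable⇒demonic all∈S ext v =
    let g , agree , _ , wrong = ext v (all∈S v)
    in  wrong ∘ trans (Strategy.local (F v) g _ λ w v~w → agree w (all∈S w) v~w)

  -- The color that the tentative coloring of `s` gives to `u` becomes final. It differs from the
  -- exceptional color of `u` for parent color `f s`, so `u` can be fooled.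
  extend-leaf : ∀ {S u s} → u ∉ S → s ∈ S → Adj T u s →
                (∀ {t} → t ∈ S → Adj T u t → t ≡ s) → (D : Exceptions n k) →
                ∃ λ D′ → ∀ f → Extendable S D′ f →
                ∃ λ a → Extendable (u ∷ S) D (updateAt f u (const a))
  extend-leaf {S} {u} {s} u∉S s∈S u~s unique D = D′ , λ f ext → proj₁ (ext s s∈S) u , extended f ext
    where
    exception = avoidsBut-misguesses 3≤k (F u) D s

    D′ : Exceptions n k
    D′ = updateAt D u (const (proj₁ ∘ exception))

    extended : ∀ f (ext : Extendable S D′ f) →
               Extendable (u ∷ S) D (updateAt f u (const (proj₁ (ext s s∈S) u)))
    extended f ext = extended-at
      where
      a  = proj₁ (ext s s∈S) u
      f′ = updateAt f u (const a)

      f′u≡a : f′ u ≡ a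
      f′u≡a = updateAt-updates u f

      f′≡f : ∀ {w} → w ∈ S → f′ w ≡ f w
      f′≡f {w} w∈S = updateAt-minimal w u f λ { refl → u∉S w∈S }

      a≢d : a ≢ proj₁ (exception (f s))
      a≢d = subst (a ≢_) (cong (λ h → h (f s)) (updateAt-updates u D))
                  (proj₁ (proj₂ (proj₂ (ext s s∈S))) u u∉S)

      -- The last hypothesis holds for `s` by the choice of `a`, and vacuously for the other old
      -- vertices.
      kept : ∀ {v} → v ∈ S → (fool : Foolable S D′ f v) →
             (Adj T v u → proj₁ fool u ≡ a) → Foolable (u ∷ S) D f′ v
      kept {v} v∈S (g , agrees , avoids , wrong) gu≡a =
        g , agree , avoid , subst (guess (F v) g ≢_) (sym (f′≡f v∈S)) wrong
        where
        agree : ∀ w → w ∈ u ∷ S → Adj T v w → g w ≡ f′ w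
        agree w (here refl) v~u = trans (gu≡a v~u) (sym f′u≡a)
        agree w (there w∈S) v~w = trans (agrees w w∈S v~w) (sym (f′≡f w∈S))

        avoid : ∀ w → w ∉ u ∷ S → g w ≢ D w (f′ v)
        avoid w w∉ gw≡ = avoids w (w∉ ∘ there) (begin
          g w         ≡⟨ gw≡ ⟩
          D w (f′ v)  ≡⟨ cong (D w) (f′≡f v∈S) ⟩
          D w (f v)   ≡⟨ cong (λ h → h (f v)) (updateAt-minimal w u D (w∉ ∘ here)) ⟨
          D′ w (f v)  ∎)
          where open ≡-Reasoning

      extended-at : Extendable (u ∷ S) D f′
      -- The exception being avoided, some view of `u` has `s` colored `f s` and makes `u`, colored
      -- `a`, guess wrongly.
      extended-at v (here refl) with g , (gs≡fs , avoids) , wrong ← proj₂ (exception (f s)) a a≢d =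
        g , agree , avoid , subst (guess (F u) g ≢_) (sym f′u≡a) wrong
        where
        agree : ∀ w → w ∈ u ∷ S → Adj T u w → g w ≡ f′ w
        agree w (here refl) u~u = contradiction u~u (Graph.irrefl T refl)
        agree w (there w∈S) u~w with refl ← unique w∈S u~w = trans gs≡fs (sym (f′≡f w∈S))

        avoid : ∀ w → w ∉ u ∷ S → g w ≢ D w (f′ u)
        avoid w w∉ = subst (λ b → g w ≢ D w b) (sym f′u≡a)
          (avoids w λ { refl → w∉ (there s∈S) })
      extended-at v (there v∈S) with v ≟ s
      ... | yes refl = kept s∈S (ext s s∈S) λ _ → refl
      ... | no  v≢s  = kept v∈S (ext v v∈S) λ v~u → contradiction (unique v∈S (Graph.sym T v~u)) v≢s

  -- Exceptions are computed from the newest vertex down to the root, colors from the root back up: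
  -- `D` concerns the vertices outside `S`, `D′` all but `r`.
  extend : ∀ {r S} → Grown T r S → (D : Exceptions n k) →
           ∃ λ D′ → ∀ f → Extendable [ r ] D′ f → ∃ λ f′ → Extendable S D f′ × f′ r ≡ f r
  extend root D = D , λ f ext → f , ext , refl
  extend {r} (grow {u = u} grown u∉S s∈S u~s unique) D =
    let D₁ , extend₁ = extend-leaf u∉S s∈S u~s unique D
        D₂ , extend₂ = extend grown D₁
    in  D₂ , λ f ext →
          let f₂ , ext₂ , f₂r≡fr = extend₂ f ext
              a  , ext₁          = extend₁ f₂ ext₂
          in  updateAt f₂ u (const a) , ext₁ ,
              trans (updateAt-minimal r u f₂ λ { refl → u∉S (root∈ grown) }) f₂r≡fr

  -- Only the value of `const c` at `r` matters, since no other vertex has been put back.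
  root-extendable : ∀ {r c} D → Misguesses (F r) c (Avoids D c) → Extendable [ r ] D (const c)
  root-extendable D (g , avoids , wrong) v (here refl) =
    g , (λ { w (here refl) v~v → contradiction v~v (Graph.irrefl T refl) }) , (λ w _ → avoids w) , wrong

  -- `D` is chosen before `c`, so one table of exceptions serves all root colors at once.
  demonic-from-root : IsTree T → ∀ r → ∃ λ D → ∀ c → Misguesses (F r) c (Avoids D c) →
                      ∃ λ f → Demonic F f × f r ≡ c
  demonic-from-root isTree r =
    let S , grown , all∈S = tree-grown isTree r
        D , extends       = extend grown unconstrained
    in  D , λ c mis →
          let f , ext , fr≡c = extends (const c) (root-extendable D mis)
          in  f , extendable⇒demonic {D = unconstrained} all∈S ext , fr≡c
    where
    -- No vertex is left outside the grown list, so any value would do.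
    unconstrained : Exceptions n k
    unconstrained _ a = a

-- From exceptions to dominance

co-singleton-size : ∀ {k} (d : Fin k) → k ∸ 1 ≤ ∣ ∁ ⁅ d ⁆ ∣
co-singleton-size {k} d = ≤-reflexive (sym (trans (∣∁p∣≡n∸∣p∣ ⁅ d ⁆) (cong (k ∸_) (∣⁅x⁆∣≡1 d))))

-- The guess is then constantly `c` on the cube of colorings avoiding the exceptions `D w c`; each
-- component omits one color.
¬misguesses⇒dominant : ∀ {n k} {G : Graph n} {r} → 3 ≤ k → (F : Strategy G k r) (D : Exceptions n k) →
                       ∀ {c} → ¬ Misguesses F c (Avoids D c) → Dominant F c
¬misguesses⇒dominant {n} {k} 3≤k F D {c} ¬mis = cube , (λ w → co-singleton-size (D w c)) ,
  λ x x∈ → ¬misguesses⇒≡ F ¬mis λ w x≡d →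
    x∈∁p⇒x∉p (x∈ w) (subst (_∈ₛ ⁅ D w c ⁆) (sym x≡d) (x∈⁅x⁆ _))
  where
  cube : Cube n k
  cube = record
    { component = λ w → ∁ ⁅ D w c ⁆
    ; nonempty  = let g , avoids , _ = avoids-meet 3≤k F D c c in
        g , λ w → x∉p⇒x∈∁p (x≢y⇒x∉⁅y⁆ (avoids w))
    }

non-dominant⇒demonic : ∀ {n} {T : Graph n} → IsTree T → ∀ r {k} → 3 ≤ k → (F : Strategies T k) →
                       ∀ c → ¬ Dominant (F r) c → ∃ λ (f : Coloring n k) → Demonic F f × f r ≡ c
non-dominant⇒demonic isTree r 3≤k F c ¬dom =
  let D , demonic = demonic-from-root 3≤k F isTree r
  in  demonic c (decidable-stable (avoids-misguesses? 3≤k (F r) D c) (¬dom ∘ ¬misguesses⇒dominant 3≤k (F r) D))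

three-colors-lose : ∀ {n} {T : Graph n} → IsTree T → Fin n → ∀ {k} → 3 ≤ k → ¬ Winnable T k
three-colors-lose isTree r 3≤k (F , ¬demonic) =
  let D , demonic   = demonic-from-root 3≤k F isTree r
      -- `fromℕ<` reads `3≤k` as 2 < k and yields the color 2, a default here.
      d , misguess  = avoids-misguesses 3≤k (F r) D (fromℕ< 3≤k)
      c , c≢d , _   = avoid-two 3≤k d d
      f , dem , _   = demonic c (misguess c c≢d)
  in  ¬demonic (f , dem)

-- Two colors

opposite-clash : ∀ (a b : Fin 2) → a ≢ b → opposite b ≢ a → ⊥
opposite-clash zero       zero       a≢b _ = a≢b refl
opposite-clash zero       (suc zero) _ ob≢a = ob≢a refl
opposite-clash (suc zero) zero       _ ob≢a = ob≢a refl
opposite-clash (suc zero) (suc zero) a≢b _ = a≢b refl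

-- One end of the edge bets that both colors agree, the other that they differ.
edge⇒winnable : ∀ {n} {G : Graph n} {i j} → Adj G i j → Winnable G 2
edge⇒winnable {n} {G} {i} {j} i~j = F , λ (x , demonic) →
  opposite-clash (x j) (x i)
    (demonic i ∘ trans (guess-i x (i ≟ i) (i ≟ j)))
    (demonic j ∘ trans (guess-j x (j ≟ i) (j ≟ j)))
  where
  -- The two decisions are arguments, so that `guess-i` and `guess-j` can split on them.
  play : ∀ v → Dec (v ≡ i) → Dec (v ≡ j) → Strategy G 2 v
  play v (yes refl) _          = record { guess = λ x → x j ; local = λ x y x≈y → x≈y j i~j }
  play v (no _)     (yes refl) = record
    { guess = λ x → opposite (x i) ; local = λ x y x≈y → cong opposite (x≈y i (Graph.sym G i~j)) }
  play v (no _)     (no _)     = record { guess = λ _ → zero ; local = λ _ _ _ → refl }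

  F : Strategies G 2
  F v = play v (v ≟ i) (v ≟ j)

  guess-i : ∀ x i≟i i≟j → guess (play i i≟i i≟j) x ≡ x j
  guess-i x (yes refl) _ = refl
  guess-i x (no i≢i)   _ = contradiction refl i≢i

  guess-j : ∀ x j≟i j≟j → guess (play j j≟i j≟j) x ≡ opposite (x i)
  guess-j x (yes refl) _          = contradiction i~j (Graph.irrefl G refl)
  guess-j x (no _)     (yes refl) = refl
  guess-j x (no _)     (no j≢j)   = contradiction refl j≢j

connected⇒edge : ∀ {n} {G : Graph n} → Connected G → 2 ≤ n → ∃ λ i → ∃ λ j → Adj G i j
-- The endpoints differ, so the walk is not empty and its first step is an edge.
connected⇒edge connected (s≤s (s≤s _)) with connected zero (suc zero)
... | 0~j ◅ _ = _ , _ , 0~j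

hat-chromatic-number-tree : ∀ {n} {T : Graph n} → IsTree T → 2 ≤ n → IsHatChromaticNumber T 2
hat-chromatic-number-tree {T = T} isTree 2≤n =
  let i , j , i~j = connected⇒edge {G = T} (IsTree.connected isTree) 2≤n in record
    { winnable = edge⇒winnable {G = T} i~j
    ; largest  = λ k win → ≮⇒≥ λ 3≤k → three-colors-lose isTree i 3≤k win
    }

theorem4 : ((n : ℕ) (T : Graph n) → IsTree T → (r : Fin n) →
    (k : ℕ) → 3 ≤ k → (F : Strategies T k) →
    (c : Fin k) → ¬ Dominant (F r) c →
    ∃ λ (f : Coloring n k) → Demonic F f × f r ≡ c)
    ×
    ((n : ℕ) (T : Graph n) → IsTree T → 2 ≤ n → IsHatChromaticNumber T 2)
theorem4 = (λ n T isTree r k → non-dominant⇒demonic isTree r) , λ n T → hat-chromatic-number-tree
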